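{- Let $q$ be a quiddity sequence of length $n$ of a periodic infinite frieze of positive integers. Let $\hat q$ be a quiddity sequence obtained from $q$ by performing an $n$-gluing, and let $\check q$ be a quiddity sequence obtained from $q$ by performing an $n$-cutting (if defined). Then $s_q=s_{\hat q}$ and $s_q=s_{\check q}$.
   Context: An infinite frieze of positive integers is an array $(m_{i,j})$, indexed by $i\in\mathbb{Z}$ and $j\ge i-2$, with $m_{i,i-2}=0$, $m_{i,i-1}=1$, with $m_{i,j}$ a positive integer for $j\ge i-1$, and with $m_{i,j}m_{i+1,j+1}-m_{i,j+1}m_{i+1,j}=1$ for all $i$ and all $j\ge i-1$. Its quiddity row is $(a_i)_{i\in\mathbb{Z}}$, $a_i=m_{i,i}$, which determines the frieze. The frieze is $n$-periodic if $m_{i+n,j+n}=m_{i,j}$ for all entries; then $q=(a_1,\dots,a_n)$ is a quiddity sequence of length $n$ of the frieze ($n$ need not be the minimal period). For a quiddity sequence $q$ of length $n$ set $s_q:=m_{1,n}-m_{2,n-1}$, where $(m_{i,j})$ is the frieze with quiddity sequence $q$. Let $q=(a_1,\dots,a_n)$ be a quiddity sequence of length $n$; indices are read cyclically modulo $n$. $n$-gluing (above a pair $(a_i,a_{i+1})$): if $n=1$, $\hat q=(a_1+2,1)$; if $n\ge2$, $\hat q=(a_1,\dots,a_{i-1},a_i+1,1,a_{i+1}+1,a_{i+2},\dots,a_n)$, which for $i=n$ is read as $(a_1+1,a_2,\dots,a_{n-1},a_n+1,1)$. $n$-cutting (above an entry $a_i=1$, defined whenever such an entry exists): if $n=2$,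 $\check q=(a_{i+1}-2)$; if $n\ge 3$, $\check q=(a_1,\dots,a_{i-2},a_{i-1}-1,a_{i+1}-1,a_{i+2},\dots,a_n)$, i.e. the entry $a_i=1$ is deleted and its two cyclic neighbours are decreased by $1$. It is known that the outcomes $\hat q$ and $\check q$ are again quiddity sequences (of lengths $n+1$ and $n-1$) of periodic infinite friezes of positive integers, and that no quiddity sequence of an infinite frieze of positive integers has two (cyclically) consecutive ones. -}

module Defs where

open import Data.Fin using (Fin; toℕ)
open import Data.Integer using (ℤ; +_; _+_; _-_; _*_; _≤_; _<_)
open import Data.List using (List; []; _∷_; _++_; length; lookup)
import Data.Nat as ℕ
open import Relation.Binary.PropositionalEquality using (_≡_)

-- The array is only meaningful for j ≥ i - 2: the values of m outside that
-- region are unconstrained and never used.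
record InfiniteFrieze : Set where
  field
    m        : ℤ → ℤ → ℤ
    zeros    : ∀ i → m i (i - + 2) ≡ + 0
    ones     : ∀ i → m i (i - + 1) ≡ + 1
    positive : ∀ i j → i - + 1 ≤ j → + 0 < m i j
    diamond  : ∀ i j → i - + 1 ≤ j →
               m i j * m (i + + 1) (j + + 1) - m i (j + + 1) * m (i + + 1) j ≡ + 1

open InfiniteFrieze public

Periodic : ℕ.ℕ → InfiniteFrieze → Set
Periodic n F = ∀ i j → i - + 2 ≤ j → m F (i + + n) (j + + n) ≡ m F i j

-- An inhabitant exhibits the list q = (a₁,…,aₙ) as a quiddity sequence of
-- length n = length q.  The period n need not be minimal.  Positions in the
-- list start at 0, whereas the entries of the quiddity are numbered from 1.
record QuidditySequence (q : List ℤ) : Set where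
  field
    nonempty : ℕ.NonZero (length q)
    frieze   : InfiniteFrieze
    periodic : Periodic (length q) frieze
    quiddity : ∀ (k : Fin (length q)) →
               m frieze (+ ℕ.suc (toℕ k)) (+ ℕ.suc (toℕ k)) ≡ lookup q k

open QuidditySequence public

-- s_q = m₁,ₙ - m₂,ₙ₋₁.  The frieze is determined by q (on j ≥ i - 2), so the
-- value does not depend on the second argument.
s : (q : List ℤ) → QuidditySequence q → ℤ
s q Q = m (frieze Q) (+ 1) (+ n) - m (frieze Q) (+ 2) (+ n - + 1)
  where n = length q

-- Gluing q q̂: the sequence q̂ arises from q by an n-gluing, n = length q.
data Gluing : List ℤ → List ℤ → Set where
  -- n = 1
  single : ∀ a → Gluing (a ∷ []) (a + + 2 ∷ + 1 ∷ [])
  -- n ≥ 2, above (aᵢ , aᵢ₊₁) with i < n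
  inner  : ∀ xs a b ys →
           Gluing (xs ++ a ∷ b ∷ ys)
                  (xs ++ a + + 1 ∷ + 1 ∷ b + + 1 ∷ ys)
  -- n ≥ 2, above (aₙ , a₁)
  wrap   : ∀ a xs b →
           Gluing (a ∷ xs ++ b ∷ [])
                  (a + + 1 ∷ xs ++ b + + 1 ∷ + 1 ∷ [])

-- Cutting q q̌: the sequence q̌ arises from q by an n-cutting, n = length q.
data Cutting : List ℤ → List ℤ → Set where
  -- n = 2, above a₁ and above a₂
  pair₁ : ∀ b → Cutting (+ 1 ∷ b ∷ []) (b - + 2 ∷ [])
  pair₂ : ∀ a → Cutting (a ∷ + 1 ∷ []) (a - + 2 ∷ [])
  -- n ≥ 3, above aᵢ with 1 < i < n
  inner : ∀ xs a b ys →
          Cutting (xs ++ a ∷ + 1 ∷ b ∷ ys)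
                  (xs ++ a - + 1 ∷ b - + 1 ∷ ys)
  -- n ≥ 3, above a₁ (neighbours a₂ and aₙ)
  first : ∀ a xs b →
          Cutting (+ 1 ∷ a ∷ xs ++ b ∷ [])
                  (a - + 1 ∷ xs ++ b - + 1 ∷ [])
  -- n ≥ 3, above aₙ (neighbours aₙ₋₁ and a₁)
  last  : ∀ a xs b →
          Cutting (a ∷ xs ++ b ∷ + 1 ∷ [])
                  (a - + 1 ∷ xs ++ b - + 1 ∷ [])

{-# OPTIONS --safe #-}
-- Write aₖ = mₖₖ.  Equating adjacent diamonds and cancelling a positive entry
-- yields the recurrence mᵢ,ⱼ₊₁ = aⱼ₊₁ mᵢ,ⱼ - mᵢ,ⱼ₋₁ along each row.  Hence s_q is
-- the trace of the product of the matrices M(aₖ) = [[aₖ , -1] , [1 , 0]].  This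
-- trace is invariant under rotation of q, and
-- M(b + 1) M(1) M(a + 1) = M(b) M(a), so gluing and cutting preserve it.
module Submission where

open import Data.Fin using (toℕ)
import Data.Fin as Fin
open import Data.Integer using (ℤ; +_; -_; _+_; _-_; _*_; _<_; +≤+; >-nonZero)
open import Data.Integer.Properties using (*-cancelˡ-≡)
open import Data.Integer.Tactic.RingSolver using (solve-∀)
open import Data.List using (List; []; _∷_; _++_; _∷ʳ_; foldl; length; lookup)
open import Data.List.Properties using (foldl-++; ++-assoc)
open import Data.Nat using (ℕ; zero; suc)
import Data.Nat as ℕ
import Data.Nat.Properties as ℕ
open import Data.Product using (_×_; _,_; proj₁; proj₂)
open import Function using (_∘_)
open import Relation.Binary.PropositionalEquality
  using (_≡_; refl; sym; trans; cong; cong₂; module ≡-Reasoning)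
open import Defs

open ≡-Reasoning

-- M(a) acting on a column vector. Along a row the vector holds two adjacent entries, the later one
-- first.
step : ℤ × ℤ → ℤ → ℤ × ℤ
step (x , y) a = a * x - y , x

run : ℤ × ℤ → List ℤ → ℤ × ℤ
run = foldl step

-- The second starting vector is -e₂, whence the minus sign: it is the pair
-- preceding the initial entries 0, 1 of a row, and step (+ 0 , - + 1) a = (1 , 0).
trace : List ℤ → ℤ
trace q = proj₁ (run (+ 1 , + 0) q) - proj₂ (run (+ 0 , - + 1) q)

combine : ℤ → ℤ → ℤ × ℤ → ℤ × ℤ → ℤ × ℤ
combine s t (x , y) (z , w) = s * x + t * z , s * y + t * w

-- Each `step` is linear, so the two starting vectors in `trace` determine `run` from every start.
run-combine : ∀ q s t u v →
              run (combine s t u v) q ≡ combine s t (run u q) (run v q)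
run-combine []      s t u v = refl
run-combine (a ∷ q) s t u@(x , y) v@(z , w) = begin
  run (step (combine s t u v) a) q
    ≡⟨ cong (λ p → run (p , s * x + t * z) q) (distr a s t x y z w) ⟩
  run (combine s t (step u a) (step v a)) q
    ≡⟨ run-combine q s t (step u a) (step v a) ⟩
  combine s t (run (step u a) q) (run (step v a) q) ∎
  where
  distr : ∀ a s t x y z w → a * (s * x + t * z) - (s * y + t * w)
                          ≡ s * (a * x - y) + t * (a * z - w)
  distr = solve-∀

-- Cyclicity of the trace, tr(PM) = tr(MP), where M = M(a) and P is the matrix product of `q`.
trace-rotate : ∀ a q → trace (a ∷ q) ≡ trace (q ∷ʳ a)
trace-rotate a q = begin
  trace (a ∷ q)
    ≡⟨ cong₂ (λ u v → proj₁ u - proj₂ v) first-column second-column ⟩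
  (a * proj₁ e + - + 1 * proj₁ f) - (+ 1 * proj₂ e + + 0 * proj₂ f)
    ≡⟨ rearrange a (proj₁ e) (proj₂ e) (proj₁ f) (proj₂ f) ⟩
  proj₁ (step e a) - proj₂ (step f a)
    ≡⟨ cong₂ (λ u v → proj₁ u - proj₂ v)
         (foldl-++ step (+ 1 , + 0) q (a ∷ [])) (foldl-++ step (+ 0 , - + 1) q (a ∷ [])) ⟨
  trace (q ∷ʳ a) ∎
  where
  e = run (+ 1 , + 0) q
  f = run (+ 0 , - + 1) q
  column₁ : ∀ a → a * + 1 - + 0 ≡ a * + 1 + - + 1 * + 0
  column₁ = solve-∀
  column₁′ : ∀ a → + 1 ≡ a * + 0 + - + 1 * - + 1
  column₁′ = solve-∀
  column₂ : ∀ a → a * + 0 - - + 1 ≡ + 1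
  column₂ = solve-∀
  -- The first step sends the starting vector to (a , 1) = a (1 , 0) - (0 , -1).
  first-column : run (+ 1 , + 0) (a ∷ q) ≡ combine a (- + 1) e f
  first-column = trans (cong (λ u → run u q) (cong₂ _,_ (column₁ a) (column₁′ a)))
                       (run-combine q a (- + 1) (+ 1 , + 0) (+ 0 , - + 1))
  second-column : run (+ 0 , - + 1) (a ∷ q) ≡ combine (+ 1) (+ 0) e f
  second-column = trans (cong (λ x → run (x , + 0) q) (column₂ a))
                        (run-combine q (+ 1) (+ 0) (+ 1 , + 0) (+ 0 , - + 1))
  rearrange : ∀ a x y z w → (a * x + - + 1 * z) - (+ 1 * y + + 0 * w) ≡ (a * x - y) - z
  rearrange = solve-∀

step-insert : ∀ u a b → step (step u a) b ≡ step (step (step u (a + + 1)) (+ 1)) (b + + 1)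
step-insert (x , y) a b = cong₂ _,_ (eq₁ a b x y) (eq₂ a x y)
  where
  eq₁ : ∀ a b x y → b * (a * x - y) - x
      ≡ (b + + 1) * (+ 1 * ((a + + 1) * x - y) - x) - ((a + + 1) * x - y)
  eq₁ = solve-∀
  eq₂ : ∀ a x y → a * x - y ≡ + 1 * ((a + + 1) * x - y) - x
  eq₂ = solve-∀

run-insert : ∀ u xs a b ys →
             run u (xs ++ a ∷ b ∷ ys) ≡ run u (xs ++ a + + 1 ∷ + 1 ∷ b + + 1 ∷ ys)
run-insert u (x ∷ xs) a b ys = run-insert (step u x) xs a b ys
run-insert u []       a b ys = cong (λ v → run v ys) (step-insert u a b)

-- The increments are equations so that cutting can use the lemma too: there `a - + 1 + + 1` equals
-- the old entry only propositionally.
trace-insert : ∀ xs a b ys {a′ b′} → a′ ≡ a + + 1 → b′ ≡ b + + 1 →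
               trace (xs ++ a ∷ b ∷ ys) ≡ trace (xs ++ a′ ∷ + 1 ∷ b′ ∷ ys)
trace-insert xs a b ys refl refl =
  cong₂ (λ u v → proj₁ u - proj₂ v) (run-insert _ xs a b ys) (run-insert _ xs a b ys)

-- Rotation brings the cyclic neighbours `b` and `a` together, in this order, which reduces the
-- claim to `trace-insert`.
trace-insert-last : ∀ a xs b {a′ b′} → a′ ≡ a + + 1 → b′ ≡ b + + 1 →
                    trace (a ∷ xs ++ b ∷ []) ≡ trace (a′ ∷ xs ++ b′ ∷ + 1 ∷ [])
trace-insert-last a xs b {a′} {b′} p r = begin
  trace (a ∷ xs ++ b ∷ [])          ≡⟨ trace-rotate a (xs ++ b ∷ []) ⟩
  trace ((xs ++ b ∷ []) ∷ʳ a)       ≡⟨ cong trace (++-assoc xs (b ∷ []) (a ∷ [])) ⟩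
  trace (xs ++ b ∷ a ∷ [])          ≡⟨ trace-insert xs b a [] r p ⟩
  trace (xs ++ b′ ∷ + 1 ∷ a′ ∷ [])  ≡⟨ cong trace (++-assoc xs (b′ ∷ + 1 ∷ []) (a′ ∷ [])) ⟨
  trace ((xs ++ b′ ∷ + 1 ∷ []) ∷ʳ a′)
                                    ≡⟨ trace-rotate a′ (xs ++ b′ ∷ + 1 ∷ []) ⟨
  trace (a′ ∷ xs ++ b′ ∷ + 1 ∷ [])  ∎

-- Here only the traces agree, both being `a`; the matrices M(1) M(a + 2) and M(a) differ.
trace-insert-single : ∀ a {a′} → a′ ≡ a + + 2 → trace (a ∷ []) ≡ trace (a′ ∷ + 1 ∷ [])
trace-insert-single a refl = eq a
  where
  eq : ∀ a → (a * + 1 - + 0) - + 0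
           ≡ (+ 1 * ((a + + 2) * + 1 - + 0) - + 1) - ((a + + 2) * + 0 - - + 1)
  eq = solve-∀

x≡x-y+y : ∀ x y → x ≡ x - y + y
x≡x-y+y = solve-∀

trace-gluing : ∀ {q q̂} → Gluing q q̂ → trace q ≡ trace q̂
trace-gluing (single a)        = trace-insert-single a refl
trace-gluing (inner xs a b ys) = trace-insert xs a b ys refl refl
trace-gluing (wrap a xs b)     = trace-insert-last a xs b refl refl

-- A cutting is undone by a gluing, so the insertion lemmas are read backwards; a leading 1 is first
-- rotated to the end.
trace-cutting : ∀ {q q̌} → Cutting q q̌ → trace q ≡ trace q̌
trace-cutting (pair₁ b) = trans (trace-rotate (+ 1) (b ∷ []))
  (sym (trace-insert-single (b - + 2) (x≡x-y+y b (+ 2))))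
trace-cutting (pair₂ a) = sym (trace-insert-single (a - + 2) (x≡x-y+y a (+ 2)))
trace-cutting (inner xs a b ys) =
  sym (trace-insert xs (a - + 1) (b - + 1) ys (x≡x-y+y a (+ 1)) (x≡x-y+y b (+ 1)))
trace-cutting (last a xs b) =
  sym (trace-insert-last (a - + 1) xs (b - + 1) (x≡x-y+y a (+ 1)) (x≡x-y+y b (+ 1)))
trace-cutting (first a xs b) = begin
  trace (+ 1 ∷ a ∷ xs ++ b ∷ [])      ≡⟨ trace-rotate (+ 1) (a ∷ xs ++ b ∷ []) ⟩
  trace (a ∷ (xs ++ b ∷ []) ∷ʳ + 1)   ≡⟨ cong (trace ∘ (a ∷_)) (++-assoc xs (b ∷ []) (+ 1 ∷ [])) ⟩
  trace (a ∷ xs ++ b ∷ + 1 ∷ [])      ≡⟨ trace-cutting (last a xs b) ⟩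
  trace (a - + 1 ∷ xs ++ b - + 1 ∷ []) ∎

module Rows (F : InfiniteFrieze) where

  -- Row i + 1 read from its initial zero on, so that row i d = mᵢ₊₁,ᵢ₊d₋₁.  With
  -- this summation order row i (suc d) computes to m F (+ suc i) (+ (d ℕ.+ i)).
  row : ℕ → ℕ → ℤ
  row i d = m F (+ suc i) (+ suc (d ℕ.+ i) - + 2)

  row-zero : ∀ i → row i 0 ≡ + 0
  row-zero i = zeros F (+ suc i)

  row-one : ∀ i → row i 1 ≡ + 1
  row-one i = ones F (+ suc i)

  row-positive : ∀ i d → + 0 < row i (suc d)
  row-positive i d = positive F (+ suc i) (+ (d ℕ.+ i)) (+≤+ (ℕ.m≤n+m i d))

  row-diamond : ∀ i d → row i (suc d) * row (suc i) (suc d)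
                      - row i (suc (suc d)) * row (suc i) d ≡ + 1
  row-diamond i d
    with e ← diamond F (+ suc i) (+ (d ℕ.+ i)) (+≤+ (ℕ.m≤n+m i d))
    -- The last rewrite exposes a second successor, so that the subtraction of 2 inside
    -- `row (suc i) d` computes.
    rewrite ℕ.+-comm i 1 | ℕ.+-comm (d ℕ.+ i) 1 | ℕ.+-suc d i = e

  -- Induction on `d` with `i` free: the hypothesis for row `suc i` concerns the same column, hence
  -- has the same coefficient.
  row-recurrence : ∀ d i → row i (suc (suc d)) ≡ row (d ℕ.+ i) 2 * row i (suc d) - row i d
  row-recurrence zero i rewrite row-zero i | row-one i = unit (row i 2)
    where
    unit : ∀ x → x ≡ x * + 1 - + 0
    unit = solve-∀
  row-recurrence (suc d) i = *-cancelˡ-≡ y′ _ _ {{>-nonZero (row-positive (suc i) d)}} (begin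
    y′ * z
      ≡⟨ isolate x y z x′ y′ z′ ⟩
    y * z′ - (y * z′ - z * y′)
      ≡⟨ cong (λ w → y * z′ - w) (trans (row-diamond i (suc d)) (sym (row-diamond i d))) ⟩
    y * z′ - (x * y′ - y * x′)
      ≡⟨ cong (λ w → y * w - (x * y′ - y * x′)) next-row ⟩
    y * (a * y′ - x′) - (x * y′ - y * x′)
      ≡⟨ factor a x y x′ y′ ⟩
    y′ * (a * y - x) ∎)
    where
    x  = row i (suc d)
    y  = row i (suc (suc d))
    z  = row i (suc (suc (suc d)))
    x′ = row (suc i) d
    y′ = row (suc i) (suc d)
    z′ = row (suc i) (suc (suc d))
    a  = row (suc d ℕ.+ i) 2
    next-row : z′ ≡ a * y′ - x′
    next-row = trans (row-recurrence d (suc i))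
                     (cong (λ k → row k 2 * y′ - x′) (ℕ.+-suc d i))
    isolate : ∀ x y z x′ y′ z′ → y′ * z ≡ y * z′ - (y * z′ - z * y′)
    isolate = solve-∀
    factor : ∀ a x y x′ y′ →
             y * (a * y′ - x′) - (x * y′ - y * x′) ≡ y′ * (a * y - x)
    factor = solve-∀

-- `f` is arbitrary because the induction passes to the shifted sequence `f ∘ suc`.
run-recurrence : ∀ q (f : ℕ → ℤ) →
  (∀ k → f (suc (suc (toℕ k))) ≡ lookup q k * f (suc (toℕ k)) - f (toℕ k)) →
  run (f 1 , f 0) q ≡ (f (suc (length q)) , f (length q))
run-recurrence []      f rec = refl
run-recurrence (a ∷ q) f rec = begin
  run (a * f 1 - f 0 , f 1) q  ≡⟨ cong (λ x → run (x , f 1) q) (rec Fin.zero) ⟨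
  run (f 2 , f 1) q            ≡⟨ run-recurrence q (f ∘ suc) (rec ∘ Fin.suc) ⟩
  (f (suc (suc (length q))) , f (suc (length q))) ∎

run-row : ∀ F i q → let open Rows F in
  (∀ k → row (toℕ k ℕ.+ i) 2 ≡ lookup q k) →
  run (+ 1 , + 0) q ≡ (row i (suc (length q)) , row i (length q))
run-row F i q entries = begin
  run (+ 1 , + 0) q
    ≡⟨ cong₂ (λ x y → run (x , y) q) (row-one i) (row-zero i) ⟨
  run (row i 1 , row i 0) q
    ≡⟨ run-recurrence q (row i) (λ k → trans (row-recurrence (toℕ k) i)
         (cong (λ a → a * row i (suc (toℕ k)) - row i (toℕ k)) (entries k))) ⟩
  (row i (suc (length q)) , row i (length q)) ∎
  where open Rows F

-- Reading all of `q` along the first row ends at m₁,ₙ. The second starting vector becomes (1 , 0)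
-- after a₁, so `q′` is read along the second row, and the lower component is m₂,ₙ₋₁.
s≡trace : ∀ q (Q : QuidditySequence q) → s q Q ≡ trace q
s≡trace []         Q with () ← nonempty Q
s≡trace q@(a ∷ q′) Q = begin
  s q Q
    ≡⟨ cong₂ (λ j l → m F (+ 1) (+ j) - m F (+ 2) (+ suc l - + 2))
         (sym (ℕ.+-identityʳ (length q))) (sym (ℕ.+-comm (length q′) 1)) ⟩
  row 0 (suc (length q)) - row 1 (length q′)
    ≡⟨ cong₂ (λ u v → proj₁ u - proj₂ v) (run-row F 0 q entries₀) (run-row F 1 q′ entries₁) ⟨
  proj₁ (run (+ 1 , + 0) q) - proj₂ (run (+ 1 , + 0) q′)
    ≡⟨ cong (λ x → proj₁ (run (+ 1 , + 0) q) - proj₂ (run (x , + 0) q′)) (start a) ⟩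
  trace q ∎
  where
  F = frieze Q
  open Rows F
  entries₀ : ∀ k → row (toℕ k ℕ.+ 0) 2 ≡ lookup q k
  entries₀ k rewrite ℕ.+-identityʳ (toℕ k) = quiddity Q k
  entries₁ : ∀ k → row (toℕ k ℕ.+ 1) 2 ≡ lookup q′ k
  entries₁ k rewrite ℕ.+-comm (toℕ k) 1 = quiddity Q (Fin.suc k)
  start : ∀ a → + 1 ≡ a * + 0 - - + 1
  start = solve-∀

s-cong : ∀ {q q′} (Q : QuidditySequence q) (Q′ : QuidditySequence q′) →
         trace q ≡ trace q′ → s q Q ≡ s q′ Q′
s-cong Q Q′ e = trans (s≡trace _ Q) (trans e (sym (s≡trace _ Q′)))

theorem3p1 : (q : List ℤ) (Q : QuidditySequence q) →
    ((q̂ : List ℤ) (Q̂ : QuidditySequence q̂) → Gluing q q̂ → s q Q ≡ s q̂ Q̂)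
    × ((q̌ : List ℤ) (Q̌ : QuidditySequence q̌) → Cutting q q̌ → s q Q ≡ s q̌ Q̌)
theorem3p1 q Q = (λ q̂ Q̂ g → s-cong Q Q̂ (trace-gluing g))
               , (λ q̌ Q̌ c → s-cong Q Q̌ (trace-cutting c))
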